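{- Let $k\geq 2$ be an integer. For any graphs $G$ and $H$ with minimum degree $\delta(H)\geq k-1$, \[ 2k|V(G)|\leq \gamma_{\times kR}(cor(G,H))\leq 2\gamma_{\times k}(cor(G,H)), \] where $cor(G,H)$ is the corona graph of $G$ and $H$.
   Context: All graphs are finite, undirected and simple. For an integer $k\geq 1$ and a graph $G=(V,E)$ with minimum degree at least $k-1$, a Roman $k$-tuple dominating function (R$k$DF) on $G$ is a function $f\colon V\to\{0,1,2\}$ such that every vertex $v$ with $f(v)=0$ has at least $k$ neighbors $w$ with $f(w)=2$, and every vertex $v$ with $f(v)\neq 0$ has at least $k-1$ neighbors $w$ with $f(w)=2$. The weight of $f$ is $f(V)=\sum_{v\in V}f(v)$, and $\gamma_{\times kR}(G)$ is the minimum weight of an R$k$DF on $G$. A $k$-tuple dominating set of $G$ is a subset $S\subseteq V$ with $|N_G[v]\cap S|\geq k$ for every $v\in V$, where $N_G[v]$ is the closed neighborhood of $v$; $\gamma_{\times k}(G)$ is the minimum cardinality of such a set. For graphs $G$ (of order $n$) and $H$, the corona graph $cor(G,H)$ is obtained by taking one copy of $G$ and $n$ disjoint copies of $H$ and joining every vertex of the $i$-th copy of $H$ to the $i$-th vertex of $G$, for each $i$. -}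

module Defs where

open import Data.Fin.Base using (Fin; zero; suc; toℕ; fromℕ<; _↑ʳ_; splitAt; remQuot; combine)
open import Data.Fin.Patterns using (0F; 2F)
open import Data.Fin.Properties
  using (_≟_; any?; all?; suc-injective; 0≢1+n; splitAt-↑ʳ; ↑ʳ-injective;
         combine-injective; remQuot-combine)
open import Data.Fin.Subset using (Subset; inside; outside; _∈_; _∪_; _∩_; _-_; ⁅_⁆; ⊤; ∣_∣)
open import Data.Fin.Subset.Properties
  using (anySubset?; x∈p⇒∣p-x∣<∣p∣; x∈p∧x≢y⇒x∈p-y; ∣p∣≤n; p⊂q⇒∣p∣<∣q∣; ∣⊤∣≡n;
         x∈⁅x⁆; p⊆p∪q; q⊆p∪q; ∩-identityʳ)
open import Data.Nat.Base
  using (ℕ; zero; suc; _+_; _*_; _∸_; _≤_; _<_; z≤n; s≤s; s≤s⁻¹; NonZero; >-nonZero; >-nonZero⁻¹)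
open import Data.Nat.Properties
  using (≤-refl; ≤-trans; ≤-<-trans; <-≤-trans; ≮⇒≥; m≤m+n; m≤n+m∸n; _≤?_; _<?_; module ≤-Reasoning)
open import Data.Product.Base using (∃; _×_; _,_; proj₁; proj₂)
open import Data.Sum.Base using (_⊎_; inj₁; inj₂; map₂)
open import Data.Vec.Base using (Vec; []; _∷_; lookup; map; sum; replicate; tabulate; here; there)
open import Data.Vec.Properties using (lookup∘tabulate; lookup⇒[]=; []=⇒lookup; lookup-replicate; map-replicate)
open import Function.Base using (_∘_)
open import Function.Definitions using (Injective)
open import Level using (0ℓ)
open import Relation.Binary.Core using (Rel)
import Relation.Binary.Definitions as B
open import Relation.Binary.PropositionalEquality
  using (_≡_; _≢_; refl; sym; trans; cong; subst)
open import Relation.Nullary.Decidable using (Dec; yes; no; does; map′; _×-dec_; _→-dec_; ¬?; dec-true)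
open import Relation.Nullary.Negation using (contradiction)
open import Relation.Unary using (Pred; Decidable; U)
open import Relation.Unary.Properties using (U?)

IsMinimum : {A : Set} → Pred A 0ℓ → (A → ℕ) → ℕ → Set
IsMinimum P μ m = (∃ λ a → P a × μ a ≡ m) × (∀ a → P a → m ≤ μ a)

Searchable : Set → Set₁
Searchable A = {Q : Pred A 0ℓ} → Decidable Q → Dec (∃ Q)

minimum : {A : Set} → Searchable A → {P : Pred A 0ℓ} → Decidable P →
          (μ : A → ℕ) → ∃ P → ∃ (IsMinimum P μ)
minimum {A} search {P} P? μ (a₀ , pa₀) = descend (suc (μ a₀)) a₀ pa₀ ≤-refl
  where
  descend : ∀ bound a → P a → μ a < bound → ∃ (IsMinimum P μ)
  descend (suc bound) a pa μa<bound
    with search (λ b → P? b ×-dec (μ b <? μ a))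
  ... | yes (b , pb , μb<μa) = descend bound b pb (<-≤-trans μb<μa (s≤s⁻¹ μa<bound))
  ... | no  ∄smaller         =
    μ a , (a , pa , refl) , λ b pb → ≮⇒≥ (λ μb<μa → ∄smaller (b , pb , μb<μa))

anyVec? : ∀ {q} n → Searchable (Vec (Fin q) n)
anyVec? zero    Q? = map′ ([] ,_) (λ { ([] , p) → p }) (Q? [])
anyVec? (suc n) Q? =
  map′ (λ { (x , xs , p) → x ∷ xs , p }) (λ { (x ∷ xs , p) → x , xs , p })
       (any? (λ x → anyVec? n (λ xs → Q? (x ∷ xs))))

-- The vertex set is nonempty, as the minimum degree of the null graph is undefined.
record Graph : Set₁ where
  field
    order    : ℕ
    nonEmpty : NonZero order

  Vertex : Set
  Vertex = Fin order

  field
    _~_      : Rel Vertex 0ℓ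
    _~?_     : B.Decidable _~_
    ~-sym    : B.Symmetric _~_
    ~-irrefl : B.Irreflexive _≡_ _~_

  N : Vertex → Subset order
  N v = tabulate (λ w → does (v ~? w))

  N[_] : Vertex → Subset order
  N[ v ] = N v ∪ ⁅ v ⁆

  degree : Vertex → ℕ
  degree v = ∣ N v ∣

  minDegree : ∃ (IsMinimum U degree)
  minDegree = minimum any? U? degree (fromℕ< (>-nonZero⁻¹ order ⦃ nonEmpty ⦄) , _)

open Graph public using (order)

δ : Graph → ℕ
δ G = proj₁ (Graph.minDegree G)

module _ (G : Graph) where
  open Graph G using (Vertex; _~_; _~?_; ~-irrefl; N; N[_]; degree; minDegree)

  ∈N⁺ : ∀ {v w} → v ~ w → w ∈ N v
  ∈N⁺ {v} {w} v~w = lookup⇒[]= w (N v) (trans (lookup∘tabulate _ w) (dec-true (v ~? w) v~w))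

  ∈N⁻ : ∀ {v w} → w ∈ N v → v ~ w
  ∈N⁻ {v} {w} w∈N with v ~? w | trans (sym (lookup∘tabulate (λ w → does (v ~? w)) w)) ([]=⇒lookup w∈N)
  ... | yes v~w | _  = v~w
  ... | no  _   | ()

  δ≤degree : ∀ v → δ G ≤ degree v
  δ≤degree v = proj₂ (proj₂ minDegree) v _

  degree<∣N[]∣ : ∀ v → degree v < ∣ N[ v ] ∣
  degree<∣N[]∣ v = p⊂q⇒∣p∣<∣q∣
    (p⊆p∪q ⁅ v ⁆ , v , q⊆p∪q (N v) ⁅ v ⁆ (x∈⁅x⁆ v) , ~-irrefl refl ∘ ∈N⁻)

-- A function V → {0,1,2} is stored as its vector of values.
Labelling : Graph → Set
Labelling G = Vec (Fin 3) (order G)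

weight : ∀ {n} → Vec (Fin 3) n → ℕ
weight f = sum (map toℕ f)

V₂ : ∀ {n} → Vec (Fin 3) n → Subset n
V₂ f = map (λ x → does (x ≟ 2F)) f

module _ (k : ℕ) (G : Graph) where
  open Graph G using (Vertex; N; N[_])

  IsRkDF : Pred (Labelling G) 0ℓ
  IsRkDF f = ∀ (v : Vertex) →
    (lookup f v ≡ 0F → k ≤ ∣ N v ∩ V₂ f ∣) ×
    (lookup f v ≢ 0F → k ∸ 1 ≤ ∣ N v ∩ V₂ f ∣)

  IsRkDF? : Decidable IsRkDF
  IsRkDF? f = all? λ v →
    ((lookup f v ≟ 0F) →-dec (k ≤? _)) ×-dec (¬? (lookup f v ≟ 0F) →-dec (k ∸ 1 ≤? _))

  IsTupleDominating : Pred (Subset (order G)) 0ℓ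
  IsTupleDominating S = ∀ (v : Vertex) → k ≤ ∣ N[ v ] ∩ S ∣

  IsTupleDominating? : Decidable IsTupleDominating
  IsTupleDominating? S = all? λ v → k ≤? _

  module _ (k-1≤δ : k ∸ 1 ≤ δ G) where

    constant2-isRkDF : IsRkDF (replicate _ 2F)
    constant2-isRkDF v = (λ f≡0 → contradiction (trans (sym (lookup-replicate v 2F)) f≡0) λ ())
                       , (λ _ → ≤-trans k-1≤δ (subst (λ p → δ G ≤ ∣ p ∣) (sym N∩V₂≡N) (δ≤degree G v)))
      where
      N∩V₂≡N : N v ∩ V₂ (replicate _ 2F) ≡ N v
      N∩V₂≡N = trans (cong (N v ∩_) (map-replicate _ 2F _)) (∩-identityʳ (N v))

    ⊤-isTupleDominating : IsTupleDominating ⊤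
    ⊤-isTupleDominating v = subst (λ p → k ≤ ∣ p ∣) (sym (∩-identityʳ N[ v ]))
      (≤-trans (m≤n+m∸n k 1) (≤-<-trans (≤-trans k-1≤δ (δ≤degree G v)) (degree<∣N[]∣ G v)))

    γ×R-minimum : ∃ (IsMinimum IsRkDF weight)
    γ×R-minimum = minimum (anyVec? _) IsRkDF? weight (_ , constant2-isRkDF)

    γ×R : ℕ
    γ×R = proj₁ γ×R-minimum

    γ×-minimum : ∃ (IsMinimum IsTupleDominating ∣_∣)
    γ×-minimum = minimum anySubset? IsTupleDominating? ∣_∣ (_ , ⊤-isTupleDominating)

    γ× : ℕ
    γ× = proj₁ γ×-minimum

module _ (G H : Graph) where
  private
    module G = Graph G
    module H = Graph H

  -- inj₁ u is the vertex u of G, and inj₂ (i , a) is the vertex a in the i-th copy of H.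
  CorVertex : Set
  CorVertex = G.Vertex ⊎ (G.Vertex × H.Vertex)

  CorAdj : Rel CorVertex 0ℓ
  CorAdj (inj₁ u)       (inj₁ v)       = u G.~ v
  CorAdj (inj₁ u)       (inj₂ (j , b)) = u ≡ j
  CorAdj (inj₂ (i , a)) (inj₁ v)       = i ≡ v
  CorAdj (inj₂ (i , a)) (inj₂ (j , b)) = i ≡ j × a H.~ b

  CorAdj? : B.Decidable CorAdj
  CorAdj? (inj₁ u)       (inj₁ v)       = u G.~? v
  CorAdj? (inj₁ u)       (inj₂ (j , b)) = u ≟ j
  CorAdj? (inj₂ (i , a)) (inj₁ v)       = i ≟ v
  CorAdj? (inj₂ (i , a)) (inj₂ (j , b)) = (i ≟ j) ×-dec (a H.~? b)

  CorAdj-sym : B.Symmetric CorAdj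
  CorAdj-sym {inj₁ _} {inj₁ _} u~v         = G.~-sym u~v
  CorAdj-sym {inj₁ _} {inj₂ _} u≡j         = sym u≡j
  CorAdj-sym {inj₂ _} {inj₁ _} i≡v         = sym i≡v
  CorAdj-sym {inj₂ _} {inj₂ _} (i≡j , a~b) = sym i≡j , H.~-sym a~b

  CorAdj-irrefl : B.Irreflexive _≡_ CorAdj
  CorAdj-irrefl {inj₁ _} refl u~u       = G.~-irrefl refl u~u
  CorAdj-irrefl {inj₂ _} refl (_ , a~a) = H.~-irrefl refl a~a

  -- A bijection, which numbers the vertices of G first and then the copies of H one by one.
  decode : Fin (G.order + G.order * H.order) → CorVertex
  decode x = map₂ (remQuot H.order) (splitAt G.order x)

  cor : Graph
  cor = record
    { order    = G.order + G.order * H.order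
    ; nonEmpty = >-nonZero (≤-trans (>-nonZero⁻¹ G.order ⦃ G.nonEmpty ⦄) (m≤m+n G.order _))
    ; _~_      = λ x y → CorAdj (decode x) (decode y)
    ; _~?_     = λ x y → CorAdj? (decode x) (decode y)
    ; ~-sym    = λ {x} {y} → CorAdj-sym {decode x} {decode y}
    ; ~-irrefl = λ {x} {y} x≡y → CorAdj-irrefl {decode x} {decode y} (cong decode x≡y)
    }

∣∣-mono-injective : ∀ {m n} {e : Fin m → Fin n} → Injective _≡_ _≡_ e →
                    (p : Subset m) {q : Subset n} → (∀ {x} → x ∈ p → e x ∈ q) → ∣ p ∣ ≤ ∣ q ∣
∣∣-mono-injective inj []            e∈q = z≤n
∣∣-mono-injective inj (outside ∷ p) e∈q = ∣∣-mono-injective (suc-injective ∘ inj) p (e∈q ∘ there)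
∣∣-mono-injective {e = e} inj (inside ∷ p) {q} e∈q =
  ≤-<-trans (∣∣-mono-injective (suc-injective ∘ inj) p {q - e zero}
               (λ x∈p → x∈p∧x≢y⇒x∈p-y (e∈q (there x∈p)) (0≢1+n ∘ sym ∘ inj)))
            (x∈p⇒∣p-x∣<∣p∣ (e∈q here))

module _ (G H : Graph) where
  private
    module G = Graph G
    module H = Graph H
    module C = Graph (cor G H)

  inCopy : G.Vertex → H.Vertex → C.Vertex
  inCopy i a = G.order ↑ʳ combine i a

  decode-inCopy : ∀ i a → decode G H (inCopy i a) ≡ inj₂ (i , a)
  decode-inCopy i a = trans
    (cong (map₂ (remQuot H.order)) (splitAt-↑ʳ G.order (G.order * H.order) (combine i a)))
    (cong inj₂ (remQuot-combine i a))

  inCopy-injective : ∀ i → Injective _≡_ _≡_ (inCopy i)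
  inCopy-injective i {a} {b} eq =
    proj₂ (combine-injective i a i b (↑ʳ-injective G.order (combine i a) (combine i b) eq))

  δH≤degree : ∀ x → δ H ≤ C.degree x
  δH≤degree x = go (decode G H x) refl
    where
    adjacent : ∀ {u i a} → decode G H x ≡ u → CorAdj G H u (inj₂ (i , a)) → inCopy i a ∈ C.N x
    adjacent {i = i} {a} refl u~ =
      ∈N⁺ (cor G H) {x} (subst (CorAdj G H (decode G H x)) (sym (decode-inCopy i a)) u~)

    go : ∀ u → decode G H x ≡ u → δ H ≤ C.degree x
    go (inj₁ i) eq = begin
      δ H              ≤⟨ δ≤degree H _ ⟩
      H.degree someH   ≤⟨ ∣p∣≤n (H.N someH) ⟩
      H.order          ≡⟨ ∣⊤∣≡n H.order ⟨
      ∣ ⊤ {H.order} ∣  ≤⟨ ∣∣-mono-injective (inCopy-injective i) ⊤ (λ _ → adjacent eq refl) ⟩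
      C.degree x       ∎
      where
      open ≤-Reasoning
      someH : H.Vertex
      someH = fromℕ< (>-nonZero⁻¹ H.order ⦃ H.nonEmpty ⦄)
    go (inj₂ (i , a)) eq = ≤-trans (δ≤degree H a)
      (∣∣-mono-injective (inCopy-injective i) (H.N a) (λ b∈N → adjacent eq (refl , ∈N⁻ H b∈N)))

  δ≤δ-cor : δ H ≤ δ (cor G H)
  δ≤δ-cor with C.minDegree
  ... | _ , (x , _ , refl) , _ = δH≤degree x

{-# OPTIONS --safe #-}

-- Upper bound: doubling the indicator function of a k-tuple dominating set gives an RkDF.
--
-- Lower bound: the blocks made of a vertex i of G and the i-th copy of H partition the
-- corona, and each has weight at least 2k.  The closed neighbourhood of a copy vertex x
-- lies in its block.  If x has label 0 or 2, then this neighbourhood contains k vertices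
-- of label 2.  If x has label 1, take a neighbour y of x in the copy (k ≥ 2); unless y
-- has label 0 or 2, the k - 1 neighbours of x of label 2 together with x and y weigh 2k.
module Submission where

open import Defs
open import Data.Bool.Base using (Bool; if_then_else_)
open import Data.Fin.Base using (Fin; zero; suc; toℕ; fromℕ<)
open import Data.Fin.Patterns using (0F; 1F; 2F)
open import Data.Fin.Properties using (_≟_)
open import Data.Fin.Subset
  using (Subset; inside; outside; _∈_; _∉_; _⊆_; _∪_; _∩_; ⁅_⁆; ∣_∣; Nonempty)
open import Data.Fin.Subset.Properties
  using (p⊆q⇒∣p∣≤∣q∣; p⊂q⇒∣p∣<∣q∣; x∈p∩q⁺; x∈p∩q⁻; x∈p∪q⁻; x∈⁅x⁆; x∈⁅y⁆⇒x≡y;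
         p⊆p∪q; q⊆p∪q; x∈p⇒∣p-x∣<∣p∣; x∈p∧x≢y⇒x∈p-y; ∪-identityʳ)
open import Data.Nat.Base
  using (ℕ; zero; suc; _+_; _*_; _∸_; _≤_; _<_; z≤n; s≤s; >-nonZero⁻¹)
open import Data.Nat.Properties
  using (≤-refl; ≤-trans; ≤-<-trans; ≤-reflexive; +-mono-≤; *-monoʳ-≤; *-suc; *-comm;
         m≤m+n; n≤1+n; m≤n+m∸n; m≤n+o⇒m∸n≤o; m<n⇒0<n∸m; +-0-commutativeMonoid; +-identityʳ; module ≤-Reasoning)
open import Data.Nat.Tactic.RingSolver using (solve-∀)
open import Data.Product.Base using (_×_; _,_; proj₁; proj₂)
open import Data.Sum.Base using (inj₁; inj₂; [_,_]′)
open import Data.Vec.Base using (Vec; []; _∷_; lookup; map; tabulate; here; there)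
open import Data.Vec.Properties
  using (lookup⇒[]=; []=⇒lookup; lookup-map; lookup∘tabulate)
open import Function.Base using (id; _∘_)
open import Relation.Binary.PropositionalEquality
  using (_≡_; _≢_; refl; sym; trans; cong; cong₂; subst; module ≡-Reasoning)
open import Relation.Nullary.Decidable using (does; yes; no; dec-true)
open import Relation.Nullary.Negation using (contradiction)

open import Algebra.Properties.CommutativeMonoid.Sum +-0-commutativeMonoid
  using (sum-syntax; sum-cong-≗; sum-replicate-zero; ∑-distrib-+)

-- Counting in subsets and finite sums.

0<∣p∣⇒Nonempty : ∀ {n} (p : Subset n) → 0 < ∣ p ∣ → Nonempty p
0<∣p∣⇒Nonempty (inside  ∷ p) _     = zero , here
0<∣p∣⇒Nonempty (outside ∷ p) 0<∣p∣ with 0<∣p∣⇒Nonempty p 0<∣p∣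
... | x , x∈p = suc x , there x∈p

∣p∪⁅x⁆∣≤1+∣p∣ : ∀ {n} (p : Subset n) x → ∣ p ∪ ⁅ x ⁆ ∣ ≤ suc ∣ p ∣
∣p∪⁅x⁆∣≤1+∣p∣ (inside  ∷ p) zero    = s≤s (≤-trans (≤-reflexive (cong ∣_∣ (∪-identityʳ p))) (n≤1+n _))
∣p∪⁅x⁆∣≤1+∣p∣ (outside ∷ p) zero    = s≤s (≤-reflexive (cong ∣_∣ (∪-identityʳ p)))
∣p∪⁅x⁆∣≤1+∣p∣ (inside  ∷ p) (suc x) = s≤s (∣p∪⁅x⁆∣≤1+∣p∣ p x)
∣p∪⁅x⁆∣≤1+∣p∣ (outside ∷ p) (suc x) = ∣p∪⁅x⁆∣≤1+∣p∣ p x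

-- Deleting `x` and then `y` lowers the cardinality strictly both times.
x≢y∈p⇒2≤∣p∣ : ∀ {n} {p : Subset n} {x y} → x ∈ p → y ∈ p → y ≢ x → 2 ≤ ∣ p ∣
x≢y∈p⇒2≤∣p∣ x∈p y∈p y≢x =
  ≤-<-trans (≤-<-trans z≤n (x∈p⇒∣p-x∣<∣p∣ (x∈p∧x≢y⇒x∈p-y y∈p y≢x))) (x∈p⇒∣p-x∣<∣p∣ x∈p)

∩-monoˡ-⊆ : ∀ {n} {p q : Subset n} (r : Subset n) → p ⊆ q → p ∩ r ⊆ q ∩ r
∩-monoˡ-⊆ {p = p} r p⊆q x∈p∩r with x∈p∩q⁻ p r x∈p∩r
... | x∈p , x∈r = x∈p∩q⁺ (p⊆q x∈p , x∈r)

m∸1≤n⇒m≤1+n : ∀ m {n} → m ∸ 1 ≤ n → m ≤ suc n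
m∸1≤n⇒m≤1+n m = ≤-trans (m≤n+m∸n m 1) ∘ s≤s

∑-lower-bound : ∀ {m c} (g : Fin m → ℕ) → (∀ i → c ≤ g i) → m * c ≤ ∑[ i < m ] g i
∑-lower-bound {zero}  g c≤g = z≤n
∑-lower-bound {suc m} g c≤g = +-mono-≤ (c≤g zero) (∑-lower-bound (g ∘ suc) (c≤g ∘ suc))

∑-select : ∀ {m} (j : Fin m) c → ∑[ i < m ] (if does (j ≟ i) then c else 0) ≡ c
∑-select {suc m} zero    c = trans (cong (c +_) (sum-replicate-zero m)) (+-identityʳ c)
∑-select {suc m} (suc j) c = ∑-select j c

-- Weight restricted to a set of vertices.

V₁ : ∀ {n} → Vec (Fin 3) n → Subset n
V₁ f = map (λ x → does (x ≟ 1F)) f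

∈V₁ : ∀ {n} (f : Vec (Fin 3) n) {x} → lookup f x ≡ 1F → x ∈ V₁ f
∈V₁ f {x} fx≡1 = lookup⇒[]= x (V₁ f) (trans (lookup-map x _ f) (cong (λ y → does (y ≟ 1F)) fx≡1))

∈V₂ : ∀ {n} (f : Vec (Fin 3) n) {x} → lookup f x ≡ 2F → x ∈ V₂ f
∈V₂ f {x} fx≡2 = lookup⇒[]= x (V₂ f) (trans (lookup-map x _ f) (cong (λ y → does (y ≟ 2F)) fx≡2))

-- Built from cardinalities rather than as a sum over `p`, so that inclusions of sets and bounds on
-- numbers of neighbours apply directly. Label 0 contributes nothing.
weightOn : ∀ {n} → Subset n → Vec (Fin 3) n → ℕ
weightOn p f = 2 * ∣ p ∩ V₂ f ∣ + ∣ p ∩ V₁ f ∣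

weightOn-∷ : ∀ {n} s x (p : Subset n) f →
             weightOn (s ∷ p) (x ∷ f) ≡ (if s then toℕ x else 0) + weightOn p f
weightOn-∷ outside x  p f = refl
weightOn-∷ inside  0F p f = refl
weightOn-∷ inside  1F p f = lemma ∣ p ∩ V₂ f ∣ ∣ p ∩ V₁ f ∣
  where
  lemma : ∀ a b → 2 * a + suc b ≡ 1 + (2 * a + b)
  lemma = solve-∀
weightOn-∷ inside  2F p f = lemma ∣ p ∩ V₂ f ∣ ∣ p ∩ V₁ f ∣
  where
  lemma : ∀ a b → 2 * suc a + b ≡ 2 + (2 * a + b)
  lemma = solve-∀

weightOn-mono : ∀ {n} {p q : Subset n} f → p ⊆ q → weightOn p f ≤ weightOn q f
weightOn-mono f p⊆q =
  +-mono-≤ (*-monoʳ-≤ 2 (p⊆q⇒∣p∣≤∣q∣ (∩-monoˡ-⊆ (V₂ f) p⊆q)))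
           (p⊆q⇒∣p∣≤∣q∣ (∩-monoˡ-⊆ (V₁ f) p⊆q))

fibre : ∀ {m n} → (Fin n → Fin m) → Fin m → Subset n
fibre β i = tabulate (λ x → does (β x ≟ i))

∈fibre : ∀ {m n} (β : Fin n → Fin m) {i x} → β x ≡ i → x ∈ fibre β i
∈fibre β {i} {x} βx≡i =
  lookup⇒[]= x (fibre β i) (trans (lookup∘tabulate _ x) (dec-true (β x ≟ i) βx≡i))

-- The fibres of `β` partition the vertices. By induction on the labelling: the head vertex lies in
-- the fibre over `β zero` only, so its label is counted exactly once.
∑-weightOn-fibre : ∀ {m n} (β : Fin n → Fin m) (f : Vec (Fin 3) n) →
                   ∑[ i < m ] weightOn (fibre β i) f ≡ weight f
∑-weightOn-fibre {m} β []      = sum-replicate-zero m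
∑-weightOn-fibre {m} β (x ∷ f) = begin
  ∑[ i < m ] weightOn (fibre β i) (x ∷ f)
    ≡⟨ sum-cong-≗ (λ i → weightOn-∷ (does (β zero ≟ i)) x (fibre (β ∘ suc) i) f) ⟩
  ∑[ i < m ] ((if does (β zero ≟ i) then toℕ x else 0) + weightOn (fibre (β ∘ suc) i) f)
    ≡⟨ ∑-distrib-+ (λ i → if does (β zero ≟ i) then toℕ x else 0) _ ⟩
  ∑[ i < m ] (if does (β zero ≟ i) then toℕ x else 0) + ∑[ i < m ] weightOn (fibre (β ∘ suc) i) f
    ≡⟨ cong₂ _+_ (∑-select (β zero) (toℕ x)) (∑-weightOn-fibre (β ∘ suc) f) ⟩
  toℕ x + weight f ∎
  where open ≡-Reasoning

-- Upper bound: doubling a dominating set.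

doubleValue : Bool → Fin 3
doubleValue s = if s then 2F else 0F

double : ∀ {n} → Subset n → Vec (Fin 3) n
double = map doubleValue

V₂-double : ∀ {n} (S : Subset n) → V₂ (double S) ≡ S
V₂-double []            = refl
V₂-double (inside  ∷ S) = cong (inside  ∷_) (V₂-double S)
V₂-double (outside ∷ S) = cong (outside ∷_) (V₂-double S)

weight-double : ∀ {n} (S : Subset n) → weight (double S) ≡ 2 * ∣ S ∣
weight-double []            = refl
weight-double (inside  ∷ S) = trans (cong (2 +_) (weight-double S)) (sym (*-suc 2 ∣ S ∣))
weight-double (outside ∷ S) = weight-double S

module _ (k : ℕ) (G : Graph) where
  open Graph G using (Vertex; N; N[_]; ~-irrefl)

  v∉N : ∀ v → v ∉ N v
  v∉N v = ~-irrefl refl ∘ ∈N⁻ G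

  -- Passing from `N[ v ]` to `N v` removes only `v`, hence at most one of the `k` dominating
  -- vertices. If `v` has label 0, it is not in `S` and nothing is lost.
  double-isRkDF : ∀ {S} → IsTupleDominating k G S → IsRkDF k G (double S)
  double-isRkDF {S} dom v rewrite V₂-double S | lookup-map v doubleValue S =
    zeroCase , λ _ → k∸1≤
    where
    k∸1≤ : k ∸ 1 ≤ ∣ N v ∩ S ∣
    k∸1≤ = m≤n+o⇒m∸n≤o k 1 (≤-trans (dom v)
      (≤-trans (p⊆q⇒∣p∣≤∣q∣ N[v]∩S⊆N∩S∪v) (∣p∪⁅x⁆∣≤1+∣p∣ (N v ∩ S) v)))
      where
      N[v]∩S⊆N∩S∪v : N[ v ] ∩ S ⊆ (N v ∩ S) ∪ ⁅ v ⁆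
      N[v]∩S⊆N∩S∪v w∈ with x∈p∩q⁻ N[ v ] S w∈
      ... | w∈N[v] , w∈S with x∈p∪q⁻ (N v) ⁅ v ⁆ w∈N[v]
      ... | inj₁ w∈N = p⊆p∪q ⁅ v ⁆ (x∈p∩q⁺ (w∈N , w∈S))
      ... | inj₂ w∈v = q⊆p∪q (N v ∩ S) ⁅ v ⁆ w∈v

    zeroCase : doubleValue (lookup S v) ≡ 0F → k ≤ ∣ N v ∩ S ∣
    zeroCase eq = ≤-trans (dom v) (p⊆q⇒∣p∣≤∣q∣ N[v]∩S⊆N∩S)
      where
      N[v]∩S⊆N∩S : N[ v ] ∩ S ⊆ N v ∩ S
      N[v]∩S⊆N∩S w∈ with x∈p∩q⁻ N[ v ] S w∈
      ... | w∈N[v] , w∈S with x∈p∪q⁻ (N v) ⁅ v ⁆ w∈N[v]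
      ... | inj₁ w∈N = x∈p∩q⁺ (w∈N , w∈S)
      -- Here `v` itself would be in `S` and so have label 2, against `eq`.
      ... | inj₂ w∈v rewrite x∈⁅y⁆⇒x≡y v w∈v | []=⇒lookup w∈S = contradiction eq λ ()

  γ×R≤2γ× : (k-1≤δ : k ∸ 1 ≤ δ G) → γ×R k G k-1≤δ ≤ 2 * γ× k G k-1≤δ
  γ×R≤2γ× k-1≤δ with γ×R-minimum k G k-1≤δ | γ×-minimum k G k-1≤δ
  ... | _ , _ , minimal | _ , (S , dom , refl) , _ =
    ≤-trans (minimal (double S) (double-isRkDF dom)) (≤-reflexive (weight-double S))

  -- Weight of a closed neighbourhood.

  module _ {f : Labelling G} (rkdf : IsRkDF k G f) where

    private
      N∩V₂⊆N[]∩V₂ : ∀ v → N v ∩ V₂ f ⊆ N[ v ] ∩ V₂ f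
      N∩V₂⊆N[]∩V₂ v = ∩-monoˡ-⊆ (V₂ f) (p⊆p∪q ⁅ v ⁆)

    2k≤weightOn-N[] : ∀ v → lookup f v ≢ 1F → 2 * k ≤ weightOn N[ v ] f
    -- The vertices of label 2 suffice; the contribution of label 1 is dropped.
    2k≤weightOn-N[] v fv≢1 = ≤-trans (*-monoʳ-≤ 2 (k≤ (lookup f v) refl)) (m≤m+n _ _)
      where
      k≤ : ∀ c → lookup f v ≡ c → k ≤ ∣ N[ v ] ∩ V₂ f ∣
      k≤ 0F fv≡0 = ≤-trans (proj₁ (rkdf v) fv≡0) (p⊆q⇒∣p∣≤∣q∣ (N∩V₂⊆N[]∩V₂ v))
      k≤ 1F fv≡1 = contradiction fv≡1 fv≢1
      k≤ 2F fv≡2 = ≤-trans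
        (m∸1≤n⇒m≤1+n k (proj₂ (rkdf v) (λ fv≡0 → contradiction (trans (sym fv≡2) fv≡0) λ ())))
        -- The inclusion is strict because `v` has label 2 and is not its own neighbour; this
        -- supplies the one vertex missing from `k ∸ 1`.
        (p⊂q⇒∣p∣<∣q∣ (N∩V₂⊆N[]∩V₂ v , v , x∈p∩q⁺ (q⊆p∪q (N v) ⁅ v ⁆ (x∈⁅x⁆ v) , ∈V₂ f fv≡2)
                     , λ v∈ → v∉N v (proj₁ (x∈p∩q⁻ (N v) (V₂ f) v∈))))

    -- The `k ∸ 1` neighbours of label 2 fall short of `2 * k` by at most 2, which `v` and `w` make
    -- up with weight 1 each.
    2k≤weightOn-N[]-pair : ∀ v w → w ∈ N v → lookup f v ≡ 1F → lookup f w ≡ 1F →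
                           2 * k ≤ weightOn N[ v ] f
    2k≤weightOn-N[]-pair v w w∈N fv≡1 fw≡1 = begin
      2 * k                                          ≤⟨ *-monoʳ-≤ 2 (m∸1≤n⇒m≤1+n k k∸1≤) ⟩
      2 * suc ∣ N[ v ] ∩ V₂ f ∣                      ≡⟨ lemma ∣ N[ v ] ∩ V₂ f ∣ ⟩
      2 * ∣ N[ v ] ∩ V₂ f ∣ + 2                      ≤⟨ +-mono-≤ ≤-refl 2≤ ⟩
      2 * ∣ N[ v ] ∩ V₂ f ∣ + ∣ N[ v ] ∩ V₁ f ∣      ∎
      where
      open ≤-Reasoning
      lemma : ∀ a → 2 * suc a ≡ 2 * a + 2
      lemma = solve-∀

      k∸1≤ : k ∸ 1 ≤ ∣ N[ v ] ∩ V₂ f ∣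
      k∸1≤ = ≤-trans (proj₂ (rkdf v) (λ fv≡0 → contradiction (trans (sym fv≡1) fv≡0) λ ()))
                     (p⊆q⇒∣p∣≤∣q∣ (N∩V₂⊆N[]∩V₂ v))

      2≤ : 2 ≤ ∣ N[ v ] ∩ V₁ f ∣
      2≤ = x≢y∈p⇒2≤∣p∣ (x∈p∩q⁺ (q⊆p∪q (N v) ⁅ v ⁆ (x∈⁅x⁆ v) , ∈V₁ f fv≡1))
                       (x∈p∩q⁺ (p⊆p∪q ⁅ v ⁆ w∈N , ∈V₁ f fw≡1))
                       (λ w≡v → v∉N v (subst (_∈ N v) w≡v w∈N))

-- Lower bound: blocks of the corona.

module _ (G H : Graph) where
  private
    module G = Graph G
    module H = Graph H
    module C = Graph (cor G H)

  blockOf : C.Vertex → G.Vertex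
  blockOf x = [ id , proj₁ ]′ (decode G H x)

  -- A vertex of the `i`-th copy is joined only to vertices of that copy and to the vertex `i` of
  -- `G`.
  N[inCopy]⊆fibre : ∀ i a → C.N[ inCopy G H i a ] ⊆ fibre blockOf i
  N[inCopy]⊆fibre i a {z} z∈ with x∈p∪q⁻ (C.N (inCopy G H i a)) ⁅ inCopy G H i a ⁆ z∈
  ... | inj₂ z∈⁅x⁆ rewrite x∈⁅y⁆⇒x≡y (inCopy G H i a) z∈⁅x⁆ =
    ∈fibre blockOf (cong [ id , proj₁ ]′ (decode-inCopy G H i a))
  ... | inj₁ z∈N = ∈fibre blockOf
    (sameBlock (decode G H z) (subst (λ u → CorAdj G H u (decode G H z)) (decode-inCopy G H i a)
                                     (∈N⁻ (cor G H) {inCopy G H i a} z∈N)))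
    where
    sameBlock : ∀ u → CorAdj G H (inj₂ (i , a)) u → [ id , proj₁ ]′ u ≡ i
    sameBlock (inj₁ _) i≡v       = sym i≡v
    sameBlock (inj₂ _) (i≡j , _) = sym i≡j

  inCopy-adjacent : ∀ i {a b} → b ∈ H.N a → inCopy G H i b ∈ C.N (inCopy G H i a)
  inCopy-adjacent i {a} {b} b∈N = ∈N⁺ (cor G H) {inCopy G H i a} {inCopy G H i b} adjacent
    where
    adjacent : CorAdj G H (decode G H (inCopy G H i a)) (decode G H (inCopy G H i b))
    adjacent rewrite decode-inCopy G H i a | decode-inCopy G H i b = refl , ∈N⁻ H b∈N

  module _ {k : ℕ} (1<k : 1 < k) (k-1≤δ : k ∸ 1 ≤ δ H)
           {f : Labelling (cor G H)} (rkdf : IsRkDF k (cor G H) f) where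

    2k≤weightOn-block : ∀ i → 2 * k ≤ weightOn (fibre blockOf i) f
    2k≤weightOn-block i = case
      where
      a : H.Vertex
      a = fromℕ< (>-nonZero⁻¹ H.order ⦃ H.nonEmpty ⦄)

      hasNeighbour : Nonempty (H.N a)
      -- From `1 < k` follows `0 < k ∸ 1`, and `k ∸ 1` is at most the degree of `a`.
      hasNeighbour = 0<∣p∣⇒Nonempty (H.N a)
        (≤-trans (m<n⇒0<n∸m 1<k) (≤-trans k-1≤δ (δ≤degree H a)))

      b : H.Vertex
      b = proj₁ hasNeighbour

      enlarge : ∀ c → 2 * k ≤ weightOn C.N[ inCopy G H i c ] f → 2 * k ≤ weightOn (fibre blockOf i) f
      enlarge c 2k≤ = ≤-trans 2k≤ (weightOn-mono f (N[inCopy]⊆fibre i c))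

      case : 2 * k ≤ weightOn (fibre blockOf i) f
      case with lookup f (inCopy G H i a) ≟ 1F | lookup f (inCopy G H i b) ≟ 1F
      ... | no  fa≢1 | _        = enlarge a (2k≤weightOn-N[] k (cor G H) rkdf _ fa≢1)
      -- Switching to the neighbour `b` is harmless, since its closed neighbourhood lies in the same
      -- block.
      ... | yes _    | no  fb≢1 = enlarge b (2k≤weightOn-N[] k (cor G H) rkdf _ fb≢1)
      ... | yes fa≡1 | yes fb≡1 = enlarge a
        (2k≤weightOn-N[]-pair k (cor G H) rkdf _ _ (inCopy-adjacent i (proj₂ hasNeighbour)) fa≡1 fb≡1)

    2k∣G∣≤weight : 2 * k * order G ≤ weight f
    2k∣G∣≤weight = begin
      2 * k * order G                                  ≡⟨ *-comm (2 * k) (order G) ⟩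
      order G * (2 * k)                                ≤⟨ ∑-lower-bound _ 2k≤weightOn-block ⟩
      ∑[ i < order G ] weightOn (fibre blockOf i) f    ≡⟨ ∑-weightOn-fibre blockOf f ⟩
      weight f                                         ∎
      where open ≤-Reasoning

theorem6 : (k : ℕ) → 2 ≤ k → (G H : Graph) (δH≥k-1 : k ∸ 1 ≤ δ H) →
    let δcor≥k-1 = ≤-trans δH≥k-1 (δ≤δ-cor G H) in
    (2 * k * order G ≤ γ×R k (cor G H) δcor≥k-1) ×
    (γ×R k (cor G H) δcor≥k-1 ≤ 2 * γ× k (cor G H) δcor≥k-1)
theorem6 k 2≤k G H δH≥k-1 = lower , γ×R≤2γ× k (cor G H) _
  where
  lower : 2 * k * order G ≤ γ×R k (cor G H) (≤-trans δH≥k-1 (δ≤δ-cor G H))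
  lower with γ×R-minimum k (cor G H) (≤-trans δH≥k-1 (δ≤δ-cor G H))
  -- Matching on `refl` replaces the minimum by the weight of a labelling `f` attaining it.
  ... | _ , (f , rkdf , refl) , _ = 2k∣G∣≤weight G H 2≤k δH≥k-1 rkdf
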